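{- No set of exactly $6$ vertices of the generalized Petersen graph $P(12,3)$ is a zero forcing set of $P(12,3)$. Hence $Z(P(12,3)) = 7$.
   Context: Let $G=(V,E)$ be a finite simple graph. Color a subset $S\subseteq V$ black and the remaining vertices white. Color change rule: a black vertex with exactly one white neighbor forces that neighbor to become black. Iterating this rule starting from $S$ until no further force is possible gives the closure $\mathrm{cl}(S)$. The set $S$ is a zero forcing set of $G$ if $\mathrm{cl}(S)=V$, and the zero forcing number $Z(G)$ is the minimum cardinality of a zero forcing set. For $n\ge 3$ and $1\le k<n/2$, the generalized Petersen graph $P(n,k)$ has the $2n$ vertices $\{u_0,\dots,u_{n-1}\}\cup\{v_0,\dots,v_{n-1}\}$ and edges $u_i\sim u_{i+1}$, $u_i\sim v_i$, and $v_i\sim v_{i+k}$ for all $i$, with indices taken modulo $n$. -}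

module Defs where

open import Data.Empty using (⊥)
open import Data.Fin.Base using (Fin; toℕ; splitAt)
open import Data.Fin.Properties using (_≟_; any?; all?; toℕ<n; toℕ-fromℕ<)
open import Data.Fin.Subset using (Subset; _∈_; _∉_; _⊆_; _⊃_; _∪_; ⁅_⁆; ∣_∣; ⊤)
open import Data.Fin.Subset.Induction using (⊃-wellFounded)
open import Data.Fin.Subset.Properties
  using (_∈?_; x∈p∪q⁻; p⊆p∪q; q⊆p∪q; x∈⁅x⁆; x∈⁅y⁆⇒x≡y; ⊆-antisym)
open import Data.Nat.Base using (ℕ; _+_; _*_; _∸_; _%_; _≤_; _<_; NonZero; >-nonZero; z≤n; s≤s)
open import Data.Nat.DivMod using (_mod_; m%n<n; m<n⇒m%n≡m; [m+n]%n≡m%n)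
open import Data.Nat.Properties
  using (_≤?_; _<?_; ≮⇒≥; ≤-trans; ≤-<-trans; +-comm; +-cancelˡ-≡; +-cancelˡ-<;
         +-mono-<; m∸n+n≡m; m≤m+n; +-identityʳ; <⇒≢)
open import Data.Product.Base using (∃; ∃₂; _×_; _,_; proj₁; proj₂)
open import Data.Sum.Base using (_⊎_; inj₁; inj₂)
open import Function.Base using (_on_; _∘_)
open import Induction.WellFounded using (Acc; acc)
open import Level using (0ℓ)
open import Relation.Binary.Construct.Closure.ReflexiveTransitive using (Star; ε; _◅_)
open import Relation.Binary.Construct.Closure.Symmetric as Sym using (SymClosure; fwd; bwd)
open import Relation.Binary.Core using (Rel)
open import Relation.Binary.Definitions using (Decidable; Irreflexive; Symmetric)
open import Relation.Binary.PropositionalEquality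
  using (_≡_; _≢_; refl; sym; trans; cong; subst)
open import Relation.Nullary using (¬_; Dec; yes; no; ¬?; contradiction)
open import Relation.Nullary.Decidable using (True; toWitness; map′; _×-dec_; _⊎-dec_; _→-dec_)

record Graph (m : ℕ) : Set₁ where
  infix 4 _~_ _~?_
  field
    _~_      : Rel (Fin m) 0ℓ
    _~?_     : Decidable _~_
    ~-sym    : Symmetric _~_
    ~-irrefl : Irreflexive _≡_ _~_

module ZeroForcing {m : ℕ} (G : Graph m) where
  open Graph G

  WhiteNeighbour : Subset m → Fin m → Fin m → Set
  WhiteNeighbour B w x = w ~ x × x ∉ B

  Forces : Subset m → Fin m → Fin m → Set
  Forces B w x =
    w ∈ B × WhiteNeighbour B w x × (∀ y → WhiteNeighbour B w y → y ≡ x)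

  data _⟶_ (B : Subset m) : Subset m → Set where
    force : ∀ {w x} → Forces B w x → B ⟶ (B ∪ ⁅ x ⁆)

  Stuck : Subset m → Set
  Stuck B = ¬ ∃₂ (Forces B)

  IsClosure : Subset m → Subset m → Set
  IsClosure S C = Star _⟶_ S C × Stuck C

  whiteNeighbour? : ∀ B w x → Dec (WhiteNeighbour B w x)
  whiteNeighbour? B w x = (w ~? x) ×-dec ¬? (x ∈? B)

  forces? : ∀ B w x → Dec (Forces B w x)
  forces? B w x = (w ∈? B) ×-dec whiteNeighbour? B w x ×-dec
    all? (λ y → whiteNeighbour? B w y →-dec (y ≟ x))

  closure-acc : ∀ S → Acc _⊃_ S → ∃ (IsClosure S)
  closure-acc S (acc rec) with any? (λ w → any? (forces? S w))
  ... | no stuck = S , ε , stuck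
  ... | yes (w , x , f@(_ , (_ , x∉S) , _))
    with C , S∪x⟶*C , stuck ← closure-acc (S ∪ ⁅ x ⁆)
           (rec (p⊆p∪q ⁅ x ⁆ , x , q⊆p∪q S ⁅ x ⁆ (x∈⁅x⁆ x) , x∉S))
    = C , force f ◅ S∪x⟶*C , stuck

  closure : ∀ S → ∃ (IsClosure S)
  closure S = closure-acc S (⊃-wellFounded S)

  cl : Subset m → Subset m
  cl S = proj₁ (closure S)

  ⟶*⇒⊆ : ∀ {S C} → Star _⟶_ S C → S ⊆ C
  ⟶*⇒⊆ ε x∈S = x∈S
  ⟶*⇒⊆ (force {x = x} _ ◅ r) = ⟶*⇒⊆ r ∘ p⊆p∪q ⁅ x ⁆

  ⊆-stuck : ∀ {S C D} → Stuck C → S ⊆ C → Star _⟶_ S D → D ⊆ C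
  ⊆-stuck stuck S⊆C ε = S⊆C
  ⊆-stuck {S} {C} stuck S⊆C (force {w} {x} (w∈S , (w~x , _) , uniq) ◅ r) =
    ⊆-stuck stuck S∪x⊆C r
    where
    x∈C : x ∈ C
    x∈C with x ∈? C
    ... | yes p  = p
    ... | no x∉C = contradiction
      (w , x , S⊆C w∈S , (w~x , x∉C) ,
        λ { y (w~y , y∉C) → uniq y (w~y , y∉C ∘ S⊆C) })
      stuck
    S∪x⊆C : S ∪ ⁅ x ⁆ ⊆ C
    S∪x⊆C p with x∈p∪q⁻ S ⁅ x ⁆ p
    ... | inj₁ q = S⊆C q
    ... | inj₂ q = subst (_∈ C) (sym (x∈⁅y⁆⇒x≡y x q)) x∈C

  -- The order of the forces is irrelevant, so cl does not depend on the
  -- forces picked by closure.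
  closure-unique : ∀ {S C} → IsClosure S C → cl S ≡ C
  closure-unique {S} (S⟶*C , stuckC) with S⟶*D , stuckD ← proj₂ (closure S) =
    ⊆-antisym (⊆-stuck stuckC (⟶*⇒⊆ S⟶*C) S⟶*D)
              (⊆-stuck stuckD (⟶*⇒⊆ S⟶*D) S⟶*C)

  IsZeroForcing : Subset m → Set
  IsZeroForcing S = cl S ≡ ⊤

  IsZeroForcingNumber : ℕ → Set
  IsZeroForcingNumber z =
    (∃ λ S → IsZeroForcing S × ∣ S ∣ ≡ z) ×
    (∀ S → IsZeroForcing S → z ≤ ∣ S ∣)

open ZeroForcing public using (IsZeroForcing; IsZeroForcingNumber)

module _ (n : ℕ) .{{_ : NonZero n}} where

  infixl 6 _⊕_
  _⊕_ : Fin n → ℕ → Fin n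
  i ⊕ k = (toℕ i + k) mod n

  pattern u i = inj₁ i
  pattern v i = inj₂ i

  PetersenEdge : ℕ → Rel (Fin n ⊎ Fin n) 0ℓ
  PetersenEdge k (u i) (u j) = j ≡ i ⊕ 1
  PetersenEdge k (u i) (v j) = j ≡ i
  PetersenEdge k (v i) (u j) = ⊥
  PetersenEdge k (v i) (v j) = j ≡ i ⊕ k

  petersenEdge? : ∀ k → Decidable (PetersenEdge k)
  petersenEdge? k (u i) (u j) = j ≟ i ⊕ 1
  petersenEdge? k (u i) (v j) = j ≟ i
  petersenEdge? k (v i) (u j) = no λ ()
  petersenEdge? k (v i) (v j) = j ≟ i ⊕ k

  ⊕-≢ : ∀ i {k} → 0 < k → k < n → i ≢ i ⊕ k
  ⊕-≢ i {k} 0<k k<n i≡i⊕k with toℕ i + k <? n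
  ... | yes i+k<n = <⇒≢ 0<k (+-cancelˡ-≡ (toℕ i) 0 k (trans (+-identityʳ _) (trans i≡ (m<n⇒m%n≡m i+k<n))))
    where
    i≡ : toℕ i ≡ (toℕ i + k) % n
    i≡ = trans (cong toℕ i≡i⊕k) (toℕ-fromℕ< (m%n<n (toℕ i + k) n))
  ... | no i+k≮n = <⇒≢ k<n (+-cancelˡ-≡ (toℕ i) k n (trans (sym r+n≡) (cong (_+ n) (sym i≡r))))
    where
    r : ℕ
    r = toℕ i + k ∸ n
    r+n≡ : r + n ≡ toℕ i + k
    r+n≡ = m∸n+n≡m (≮⇒≥ i+k≮n)
    r<n : r < n
    r<n = +-cancelˡ-< n r n
      (subst (_< n + n) (trans (sym r+n≡) (+-comm r n)) (+-mono-< (toℕ<n i) k<n))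
    i≡r : toℕ i ≡ r
    i≡r = trans (cong toℕ i≡i⊕k) (trans (toℕ-fromℕ< (m%n<n (toℕ i + k) n))
      (trans (cong (_% n) (sym r+n≡)) (trans ([m+n]%n≡m%n r n) (m<n⇒m%n≡m r<n))))

  petersenEdge-irrefl : ∀ {k} → 1 < n → 0 < k → k < n → ∀ x → ¬ PetersenEdge k x x
  petersenEdge-irrefl 1<n 0<k k<n (u i) = ⊕-≢ i (s≤s z≤n) 1<n
  petersenEdge-irrefl 1<n 0<k k<n (v i) = ⊕-≢ i 0<k k<n

-- The vertex u i is i ↑ˡ n and the vertex v i is n ↑ʳ i.
P : (n k : ℕ) {3≤n : True (3 ≤? n)} {1≤k : True (1 ≤? k)} {2k<n : True (2 * k <? n)} →
    Graph (n + n)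
P n k {3≤n} {1≤k} {2k<n} = record
  { _~_      = SymClosure (PetersenEdge n k) on splitAt n
  ; _~?_     = λ x y → adjacent? (splitAt n x) (splitAt n y)
  ; ~-sym    = Sym.symmetric (PetersenEdge n k)
  ; ~-irrefl = λ { {x} refl → λ where
      (fwd e) → irrefl (splitAt n x) e
      (bwd e) → irrefl (splitAt n x) e }
  }
  where
  instance
    n≢0 : NonZero n
    n≢0 = >-nonZero (≤-trans (s≤s z≤n) (toWitness 3≤n))

  adjacent? : Decidable (SymClosure (PetersenEdge n k))
  adjacent? x y = map′ (λ { (inj₁ e) → fwd e ; (inj₂ e) → bwd e })
                       (λ { (fwd e) → inj₁ e ; (bwd e) → inj₂ e })
                       (petersenEdge? n k x y ⊎-dec petersenEdge? n k y x)

  irrefl : ∀ x → ¬ PetersenEdge n k x x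
  irrefl = petersenEdge-irrefl n (≤-trans (s≤s (s≤s z≤n)) (toWitness 3≤n))
    (toWitness 1≤k) (≤-<-trans (m≤m+n k _) (toWitness 2k<n))

{-# OPTIONS --safe #-}
-- If X is not stuck then some w ∈ X forces some x, and X ∪ ⁅ x ⁆ contains the
-- closed neighbourhood N[ w ].  Write (B , s) for the claim that no superset of B
-- with at most ∣ B ∣ + s elements is zero forcing.  Then (B , s) follows from the
-- claims (B ∪ N[ w ] , s + 1 - ∣ N[ w ] ─ B ∣), where w ranges over the vertices
-- with N[ w ] ⊈ B.  Unless ∣ N[ w ] ─ B ∣ = 1 the slack drops, and if
-- ∣ N[ w ] ─ B ∣ = 1 for some w then this w alone suffices; so the tree of claims
-- below (⊥ , 6) is small enough to be searched by evaluation.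
module Submission where

open import Defs
open import Data.Bool.Base using (true)
import Data.Empty as Empty
open import Data.Fin.Base using (Fin)
open import Data.Fin.Properties using (_≟_; any?)
open import Data.Fin.Subset
  using (Subset; inside; outside; _∈_; _⊆_; _∪_; ⁅_⁆; ∣_∣; ⊥)
open import Data.Fin.Subset.Properties
  using (_∈?_; ⊆-trans; ⊆-antisym; ⊆-min; ⊆-max; drop-∷-⊆; x∈⁅x⁆; x∈p∪q⁻; p⊆p∪q; q⊆p∪q;
         ∣⊥∣≡0; ∣⊤∣≡n; ∣⁅x⁆∣≡1; p⊆q⇒∣p∣≤∣q∣)
open import Data.Nat.Base using (ℕ; zero; suc; _+_; _∸_; _≤_; _<_; z≤n; s≤s)
import Data.Nat.Properties as ℕ
open import Data.Product.Base using (∃₂; _×_; _,_; proj₂)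
open import Data.Sum.Base using (_⊎_; inj₁; inj₂; [_,_]′)
open import Data.Vec.Base using (Vec; []; _∷_; here; there; tabulate; replicate; _++_)
open import Data.Vec.Properties using (lookup∘tabulate; []=⇒lookup; lookup⇒[]=)
open import Data.Vec.Relation.Unary.All as All using (All)
open import Data.Vec.Relation.Unary.All.Properties using (tabulate⁻)
open import Data.Vec.Relation.Unary.Any as Any using (Any)
open import Relation.Binary.Construct.Closure.ReflexiveTransitive using (ε)
open import Relation.Binary.PropositionalEquality using (_≡_; refl; sym; trans; cong; subst)
open import Relation.Nullary using (¬_; Dec; yes; no; does; contradiction)
open import Relation.Nullary.Decidable using (_⊎-dec_; _×-dec_; dec-true; decidable-stable)

dec-true⁻ : ∀ {a} {A : Set a} (a? : Dec A) → does a? ≡ true → A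
dec-true⁻ (yes a) _ = a

-- Equals ∣ q ─ p ∣, but evaluates much faster.
excess : ∀ {m} → Subset m → Subset m → ℕ
excess []            []            = 0
excess (inside  ∷ p) (_       ∷ q) = excess p q
excess (outside ∷ p) (inside  ∷ q) = suc (excess p q)
excess (outside ∷ p) (outside ∷ q) = excess p q

∣p∪q∣≡∣p∣+excess : ∀ {m} (p q : Subset m) → ∣ p ∪ q ∣ ≡ ∣ p ∣ + excess p q
∣p∪q∣≡∣p∣+excess []            []            = refl
∣p∪q∣≡∣p∣+excess (inside  ∷ p) (_       ∷ q) = cong suc (∣p∪q∣≡∣p∣+excess p q)
∣p∪q∣≡∣p∣+excess (outside ∷ p) (inside  ∷ q) =
  trans (cong suc (∣p∪q∣≡∣p∣+excess p q)) (sym (ℕ.+-suc ∣ p ∣ _))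
∣p∪q∣≡∣p∣+excess (outside ∷ p) (outside ∷ q) = ∣p∪q∣≡∣p∣+excess p q

excess-antitone : ∀ {m} {p q : Subset m} r → p ⊆ q → excess q r ≤ excess p r
excess-antitone {p = []}          {[]}          []            _   = z≤n
excess-antitone {p = inside  ∷ p} {inside  ∷ q} (_       ∷ r) p⊆q = excess-antitone r (drop-∷-⊆ p⊆q)
excess-antitone {p = inside  ∷ p} {outside ∷ q} _             p⊆q = contradiction (p⊆q here) λ ()
excess-antitone {p = outside ∷ p} {inside  ∷ q} (inside  ∷ r) p⊆q =
  ℕ.m≤n⇒m≤1+n (excess-antitone r (drop-∷-⊆ p⊆q))
excess-antitone {p = outside ∷ p} {inside  ∷ q} (outside ∷ r) p⊆q = excess-antitone r (drop-∷-⊆ p⊆q)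
excess-antitone {p = outside ∷ p} {outside ∷ q} (inside  ∷ r) p⊆q =
  s≤s (excess-antitone r (drop-∷-⊆ p⊆q))
excess-antitone {p = outside ∷ p} {outside ∷ q} (outside ∷ r) p⊆q = excess-antitone r (drop-∷-⊆ p⊆q)

excess≡0⇒⊆ : ∀ {m} (p q : Subset m) → excess p q ≡ 0 → q ⊆ p
excess≡0⇒⊆ (inside  ∷ p) (_       ∷ q) e≡0 here        = here
excess≡0⇒⊆ (inside  ∷ p) (_       ∷ q) e≡0 (there x∈q) = there (excess≡0⇒⊆ p q e≡0 x∈q)
excess≡0⇒⊆ (outside ∷ p) (outside ∷ q) e≡0 (there x∈q) = there (excess≡0⇒⊆ p q e≡0 x∈q)

excess≤∣q∣ : ∀ {m} (p q : Subset m) → excess p q ≤ ∣ q ∣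
excess≤∣q∣ []            []            = z≤n
excess≤∣q∣ (inside  ∷ p) (inside  ∷ q) = ℕ.m≤n⇒m≤1+n (excess≤∣q∣ p q)
excess≤∣q∣ (inside  ∷ p) (outside ∷ q) = excess≤∣q∣ p q
excess≤∣q∣ (outside ∷ p) (inside  ∷ q) = s≤s (excess≤∣q∣ p q)
excess≤∣q∣ (outside ∷ p) (outside ∷ q) = excess≤∣q∣ p q

∣p∪⁅x⁆∣≤1+∣p∣ : ∀ {m} (p : Subset m) x → ∣ p ∪ ⁅ x ⁆ ∣ ≤ suc ∣ p ∣
∣p∪⁅x⁆∣≤1+∣p∣ p x = begin
  ∣ p ∪ ⁅ x ⁆ ∣            ≡⟨ ∣p∪q∣≡∣p∣+excess p ⁅ x ⁆ ⟩
  ∣ p ∣ + excess p ⁅ x ⁆   ≤⟨ ℕ.+-monoʳ-≤ ∣ p ∣ (excess≤∣q∣ p ⁅ x ⁆) ⟩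
  ∣ p ∣ + ∣ ⁅ x ⁆ ∣        ≡⟨ cong (∣ p ∣ +_) (∣⁅x⁆∣≡1 x) ⟩
  ∣ p ∣ + 1                ≡⟨ ℕ.+-comm ∣ p ∣ 1 ⟩
  suc ∣ p ∣                ∎
  where open ℕ.≤-Reasoning

∪-lub : ∀ {m} {p q r : Subset m} → p ⊆ r → q ⊆ r → p ∪ q ⊆ r
∪-lub {p = p} {q} p⊆r q⊆r x∈p∪q = [ p⊆r , q⊆r ]′ (x∈p∪q⁻ p q x∈p∪q)

module _ {m : ℕ} (N : Vec (Subset m) m) where

  -- The first argument bounds the depth of the search tree and makes the recursion structural. In
  -- the branching case `∣ B ∣ + s < m` keeps the supersets in question proper, so a zero forcing
  -- one admits a force. The forcing vertex cannot have excess 0, as it would have no white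
  -- neighbour, nor excess above `suc s`, as its closed neighbourhood would not fit.
  Refuted : ℕ → Subset m → ℕ → Set
  Refuted zero    B s = Empty.⊥
  Refuted (suc k) B s =
    Any (λ n → excess B n ≡ 1 × Refuted k (B ∪ n) s) N ⊎
    (∣ B ∣ + s < m ×
     All (λ n → excess B n ≡ 0 ⊎ suc s < excess B n ⊎
                Refuted k (B ∪ n) (suc s ∸ excess B n)) N)

  refuted? : ∀ k B s → Dec (Refuted k B s)
  refuted? zero    B s = no λ ()
  refuted? (suc k) B s =
    Any.any? (λ n → (excess B n ℕ.≟ 1) ×-dec refuted? k (B ∪ n) s) N ⊎-dec
    ((∣ B ∣ + s ℕ.<? m) ×-dec
     All.all? (λ n → (excess B n ℕ.≟ 0) ⊎-dec (suc s ℕ.<? excess B n) ⊎-dec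
                     refuted? k (B ∪ n) (suc s ∸ excess B n)) N)

module _ {m : ℕ} (G : Graph m) where
  open Graph G
  open ZeroForcing G hiding (IsZeroForcing)

  -- `cl T` is stuck and contains `S`, so the forces starting from `S` never leave it.
  isZeroForcing-mono : ∀ {S T} → S ⊆ T → IsZeroForcing G S → IsZeroForcing G T
  isZeroForcing-mono {S} {T} S⊆T clS≡⊤
    with S⟶*C , _ ← proj₂ (closure S) | T⟶*D , stuck ← proj₂ (closure T) =
    ⊆-antisym (⊆-max _)
      (subst (_⊆ cl T) clS≡⊤ (⊆-stuck stuck (⊆-trans S⊆T (⟶*⇒⊆ T⟶*D)) S⟶*C))

  -- Otherwise the empty run of forces makes `S` its own closure, so `S` would have all `m`
  -- elements. Searching for a force is decidable, which removes the double negation.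
  isZeroForcing⇒forces : ∀ {S} → IsZeroForcing G S → ∣ S ∣ < m → ∃₂ (Forces S)
  isZeroForcing⇒forces {S} clS≡⊤ ∣S∣<m =
    decidable-stable (any? λ w → any? (forces? S w)) λ stuck →
      ℕ.<⇒≢ ∣S∣<m (trans (cong ∣_∣ (trans (sym (closure-unique (ε , stuck))) clS≡⊤)) (∣⊤∣≡n m))

  closedNeighbour? : ∀ w y → Dec (y ≡ w ⊎ w ~ y)
  closedNeighbour? w y = (y ≟ w) ⊎-dec (w ~? y)

  closedNeighbourhood : Fin m → Subset m
  closedNeighbourhood w = tabulate λ y → does (closedNeighbour? w y)

  closedNeighbourhood⁺ : ∀ {w y} → y ≡ w ⊎ w ~ y → y ∈ closedNeighbourhood w
  closedNeighbourhood⁺ {w} {y} y∈N = lookup⇒[]= y _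
    (trans (lookup∘tabulate _ y) (dec-true (closedNeighbour? w y) y∈N))

  closedNeighbourhood⁻ : ∀ {w y} → y ∈ closedNeighbourhood w → y ≡ w ⊎ w ~ y
  closedNeighbourhood⁻ {w} {y} y∈N =
    dec-true⁻ (closedNeighbour? w y) (trans (sym (lookup∘tabulate _ y)) ([]=⇒lookup y∈N))

  -- `w` is black already, and `x` is its only white neighbour.
  forces⇒closedNeighbourhood⊆ : ∀ {X w x} → Forces X w x → closedNeighbourhood w ⊆ X ∪ ⁅ x ⁆
  forces⇒closedNeighbourhood⊆ {X} {w} {x} (w∈X , _ , unique) {y} y∈N
    with closedNeighbourhood⁻ y∈N | y ∈? X
  ... | _         | yes y∈X = p⊆p∪q ⁅ x ⁆ y∈X
  ... | inj₁ refl | no  y∉X = contradiction w∈X y∉X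
  ... | inj₂ w~y  | no  y∉X with refl ← unique y (w~y , y∉X) = q⊆p∪q X ⁅ x ⁆ (x∈⁅x⁆ x)

  -- Induction on `k`: `B` and `X` grow together, and by monotonicity the larger `X` is still zero
  -- forcing.
  refuted⇒¬isZeroForcing : ∀ k {B s X} → Refuted (tabulate closedNeighbourhood) k B s →
    B ⊆ X → ∣ X ∣ ≤ ∣ B ∣ + s → ¬ IsZeroForcing G X
  refuted⇒¬isZeroForcing (suc k) {B} {s} {X} (inj₁ absorb) B⊆X ∣X∣≤ zf
    with n , e≡1 , r ← Any.satisfied absorb =
    -- `X` may fail to contain `n`, so both sets absorb it. As `B ⊆ X`, `X` gains at most as many
    -- elements as `B`, and the slack `s` survives.
    refuted⇒¬isZeroForcing k r (∪-lub (⊆-trans B⊆X (p⊆p∪q n)) (q⊆p∪q X n)) ∣X∪n∣≤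
      (isZeroForcing-mono (p⊆p∪q n) zf)
    where
    open ℕ.≤-Reasoning
    ∣X∪n∣≤ : ∣ X ∪ n ∣ ≤ ∣ B ∪ n ∣ + s
    ∣X∪n∣≤ = begin
      ∣ X ∪ n ∣                 ≡⟨ ∣p∪q∣≡∣p∣+excess X n ⟩
      ∣ X ∣ + excess X n        ≤⟨ ℕ.+-mono-≤ ∣X∣≤ (excess-antitone n B⊆X) ⟩
      ∣ B ∣ + s + excess B n    ≡⟨ ℕ.+-assoc ∣ B ∣ s _ ⟩
      ∣ B ∣ + (s + excess B n)  ≡⟨ cong (∣ B ∣ +_) (ℕ.+-comm s _) ⟩
      ∣ B ∣ + (excess B n + s)  ≡⟨ ℕ.+-assoc ∣ B ∣ _ s ⟨
      ∣ B ∣ + excess B n + s    ≡⟨ cong (_+ s) (∣p∪q∣≡∣p∣+excess B n) ⟨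
      ∣ B ∪ n ∣ + s             ∎
  refuted⇒¬isZeroForcing (suc k) {B} {s} {X} (inj₂ (B+s<m , branch)) B⊆X ∣X∣≤ zf
    with w , x , f@(_ , (w~x , x∉X) , _) ← isZeroForcing⇒forces zf (ℕ.≤-<-trans ∣X∣≤ B+s<m)
    with tabulate⁻ branch w
  -- Here the forced vertex `x`, a neighbour of `w`, would already be in `B`.
  ... | inj₁ e≡0 = x∉X (B⊆X (excess≡0⇒⊆ B _ e≡0 (closedNeighbourhood⁺ (inj₂ w~x))))
  ... | inj₂ rest = [ (λ 1+s<e → ℕ.<⇒≱ 1+s<e e≤1+s) , refute ]′ rest
    where
    open ℕ.≤-Reasoning
    n : Subset m
    n = closedNeighbourhood w
    e : ℕ
    e = excess B n
    B∪n⊆X∪x : B ∪ n ⊆ X ∪ ⁅ x ⁆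
    B∪n⊆X∪x = ∪-lub (⊆-trans B⊆X (p⊆p∪q ⁅ x ⁆)) (forces⇒closedNeighbourhood⊆ f)
    ∣X∪x∣≤ : ∣ X ∪ ⁅ x ⁆ ∣ ≤ ∣ B ∣ + suc s
    ∣X∪x∣≤ = begin
      ∣ X ∪ ⁅ x ⁆ ∣    ≤⟨ ∣p∪⁅x⁆∣≤1+∣p∣ X x ⟩
      suc ∣ X ∣        ≤⟨ s≤s ∣X∣≤ ⟩
      suc (∣ B ∣ + s)  ≡⟨ ℕ.+-suc ∣ B ∣ s ⟨
      ∣ B ∣ + suc s    ∎
    e≤1+s : e ≤ suc s
    e≤1+s = ℕ.+-cancelˡ-≤ ∣ B ∣ e (suc s) (begin
      ∣ B ∣ + e      ≡⟨ ∣p∪q∣≡∣p∣+excess B n ⟨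
      ∣ B ∪ n ∣      ≤⟨ p⊆q⇒∣p∣≤∣q∣ B∪n⊆X∪x ⟩
      ∣ X ∪ ⁅ x ⁆ ∣  ≤⟨ ∣X∪x∣≤ ⟩
      ∣ B ∣ + suc s  ∎)
    refute : ¬ Refuted (tabulate closedNeighbourhood) k (B ∪ n) (suc s ∸ e)
    -- By `e≤1+s` the truncated subtraction in the new slack is exact.
    refute r = refuted⇒¬isZeroForcing k r B∪n⊆X∪x (begin
      ∣ X ∪ ⁅ x ⁆ ∣              ≤⟨ ∣X∪x∣≤ ⟩
      ∣ B ∣ + suc s              ≡⟨ cong (∣ B ∣ +_) (ℕ.m+[n∸m]≡n e≤1+s) ⟨
      ∣ B ∣ + (e + (suc s ∸ e))  ≡⟨ ℕ.+-assoc ∣ B ∣ e _ ⟨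
      ∣ B ∣ + e + (suc s ∸ e)    ≡⟨ cong (_+ (suc s ∸ e)) (∣p∪q∣≡∣p∣+excess B n) ⟨
      ∣ B ∪ n ∣ + (suc s ∸ e)    ∎)
      (isZeroForcing-mono (p⊆p∪q ⁅ x ⁆) zf)

  -- The premise is a Boolean equation so that a concrete graph is settled by evaluation alone.
  refuted?⇒¬isZeroForcing : ∀ k {s} →
    does (refuted? (tabulate closedNeighbourhood) k ⊥ s) ≡ true →
    ∀ S → ∣ S ∣ ≤ s → ¬ IsZeroForcing G S
  refuted?⇒¬isZeroForcing k {s} eq S ∣S∣≤s =
    refuted⇒¬isZeroForcing k (dec-true⁻ (refuted? _ k ⊥ s) eq) (⊆-min S)
      (subst (λ b → ∣ S ∣ ≤ b + s) (sym (∣⊥∣≡0 m)) ∣S∣≤s)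

P[12,3]-≤6⇒¬isZeroForcing : ∀ S → ∣ S ∣ ≤ 6 → ¬ IsZeroForcing (P 12 3) S
-- Depth 10 is enough for the search to close every branch; `refl` runs it.
P[12,3]-≤6⇒¬isZeroForcing = refuted?⇒¬isZeroForcing (P 12 3) 10 refl

-- Outer vertices 1 to 5 force their spokes; inner 1, 2, 4, 5 then force inner 10, 11, 7, 8, and
-- these force their outer partners. Outer 0 and 6 force inner 0 and 6, outer 8 forces outer 9,
-- which forces inner 9.
u₀,…,u₆ : Subset 24
u₀,…,u₆ = replicate 7 inside ++ replicate 17 outside

proposition3 : (∀ (S : Subset 24) → ∣ S ∣ ≡ 6 → ¬ (IsZeroForcing (P 12 3) S)) ×
    IsZeroForcingNumber (P 12 3) 7
proposition3 =
  (λ S ∣S∣≡6 → P[12,3]-≤6⇒¬isZeroForcing S (ℕ.≤-reflexive ∣S∣≡6)) ,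
  (u₀,…,u₆ , refl , refl) ,
  λ S zf → ℕ.≰⇒> (λ ∣S∣≤6 → P[12,3]-≤6⇒¬isZeroForcing S ∣S∣≤6 zf)
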